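{- The transition system space $\mathrm{PA}^*_{01}$ is less expressive than the transition system space $\bigcup_\gamma \mathrm{ACP}^*_{01}$ (the disjoint union of the spaces $\mathrm{ACP}^*_{01}$ over all communication functions $\gamma$ on $A$): every $\mathrm{PA}^*_{01}$ expression is bisimilar to some state of $\bigcup_\gamma\mathrm{ACP}^*_{01}$, and some state of $\bigcup_\gamma\mathrm{ACP}^*_{01}$ is not bisimilar to any $\mathrm{PA}^*_{01}$ expression.
   Context: Fix a non-empty set $A$ of actions. A communication function is an associative and commutative partial binary operation $\gamma: A\times A\rightharpoonup A$. $\mathrm{ACP}^*_{01}$ expressions are generated by $p ::= \mathbf{0} \mid \mathbf{1} \mid a \mid p\cdot p \mid p+p \mid p^* \mid p\parallel p \mid \partial_H(p)$ with $a\in A$, $H\subseteq A$; $\mathrm{PA}^*_{01}$ expressions are those without $\partial_H$. For a given $\gamma$, the transition relation $p\xrightarrow{a}p'$ and termination predicate $p\downarrow$ of $\mathrm{ACP}^*_{01}$ are the least relations such that: $\mathbf{1}\downarrow$; $a\xrightarrow{a}\mathbf{1}$; if $p\xrightarrow{a}p'$ then $p+q\xrightarrow{a}p'$ and $q+p\xrightarrow{a}p'$; if $p\downarrow$ then $(p+q)\downarrow$ and $(q+p)\downarrow$; if $p\xrightarrow{a}p'$ then $p\cdot q\xrightarrow{a}p'\cdot q$; if $p\downarrow$ and $q\xrightarrow{a}q'$ then $p\cdot q\xrightarrow{a}q'$; if $p\downarrow$ and $q\downarrow$ then $(p\cdot q)\downarrow$; if $p\xrightarrow{a}p'$ then $p^*\xrightarrow{a}p'\cdot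 p^*$; $p^*\downarrow$; if $p\xrightarrow{a}p'$ then $p\parallel q\xrightarrow{a}p'\parallel q$; if $q\xrightarrow{a}q'$ then $p\parallel q\xrightarrow{a}p\parallel q'$; if $p\downarrow$ and $q\downarrow$ then $(p\parallel q)\downarrow$; if $p\xrightarrow{a}p'$, $q\xrightarrow{b}q'$ and $\gamma(a,b)$ is defined then $p\parallel q\xrightarrow{\gamma(a,b)}p'\parallel q'$; if $p\xrightarrow{a}p'$ and $a\notin H$ then $\partial_H(p)\xrightarrow{a}\partial_H(p')$; if $p\downarrow$ then $\partial_H(p)\downarrow$. The transition system space $\mathrm{PA}^*_{01}$ consists of the $\mathrm{PA}^*_{01}$ expressions with the relations obtained from all rules except the communication and encapsulation rules (equivalently, with $\gamma$ everywhere undefined). A bisimulation between transition system spaces $(S_1,\to_1,\downarrow_1)$ and $(S_2,\to_2,\downarrow_2)$ is a relation $R\subseteq S_1\times S_2$ such that whenever $s_1 R s_2$: each $s_1\xrightarrow{a}_1 s_1'$ is matched by some $s_2\xrightarrow{a}_2 s_2'$ with $s_1' R s_2'$; symmetrically for $s_2$; and $s_1\downarrow_1$ iff $s_2\downarrow_2$. States are bisimilar if related by some bisimulation. $T_1$ is less expressive than $T_2$ if every state of $T_1$ is bisimilar to a state of $T_2$ and some state of $T_2$ is bisimilar to no state of $T_1$. -}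

module Defs where

open import Level using (Level; _⊔_; 0ℓ) renaming (suc to lsuc)
open import Data.Maybe using (Maybe; just; nothing; _>>=_)
open import Data.Product using (Σ; ∃; _×_; _,_)
open import Relation.Nullary using (¬_)
open import Relation.Binary.PropositionalEquality using (_≡_)
open import Function.Bundles using (_⇔_)

record TSS (A : Set) (ℓ : Level) : Set (lsuc ℓ) where
  field
    State : Set ℓ
    _⟶[_]_ : State → A → State → Set ℓ
    _↓ : State → Set ℓ

module _ {A : Set} {ℓ₁ ℓ₂ : Level} (T₁ : TSS A ℓ₁) (T₂ : TSS A ℓ₂) where
  private
    module T₁ = TSS T₁
    module T₂ = TSS T₂

  IsBisimulation : (T₁.State → T₂.State → Set (ℓ₁ ⊔ ℓ₂)) → Set (ℓ₁ ⊔ ℓ₂)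
  IsBisimulation R =
    ∀ s₁ s₂ → R s₁ s₂ →
      (∀ a s₁' → s₁ T₁.⟶[ a ] s₁' → Σ T₂.State λ s₂' → (s₂ T₂.⟶[ a ] s₂') × R s₁' s₂')
    × (∀ a s₂' → s₂ T₂.⟶[ a ] s₂' → Σ T₁.State λ s₁' → (s₁ T₁.⟶[ a ] s₁') × R s₁' s₂')
    × (s₁ T₁.↓ ⇔ s₂ T₂.↓)

  Bisimilar : T₁.State → T₂.State → Set (lsuc (ℓ₁ ⊔ ℓ₂))
  Bisimilar s₁ s₂ =
    Σ (T₁.State → T₂.State → Set (ℓ₁ ⊔ ℓ₂)) λ R → IsBisimulation R × R s₁ s₂

  LessExpressive : Set (lsuc (ℓ₁ ⊔ ℓ₂))
  LessExpressive =
      (∀ (s₁ : T₁.State) → Σ T₂.State λ s₂ → Bisimilar s₁ s₂)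
    × (Σ T₂.State λ s₂ → ∀ (s₁ : T₁.State) → ¬ Bisimilar s₁ s₂)

record CommFun (A : Set) : Set where
  field
    γ : A → A → Maybe A
    comm : ∀ a b → γ a b ≡ γ b a
    assoc : ∀ a b c → (γ a b >>= λ d → γ d c) ≡ (γ b c >>= λ e → γ a e)

data ACP (A : Set) : Set₁ where
  𝟘 𝟙 : ACP A
  act : A → ACP A
  _·_ _+_ _∥_ : ACP A → ACP A → ACP A
  _* : ACP A → ACP A
  ∂ : (A → Set) → ACP A → ACP A

module _ {A : Set} (C : CommFun A) where
  open CommFun C

  data _↓ᴬ : ACP A → Set₁ where
    𝟙↓ : 𝟙 ↓ᴬ
    +↓ˡ : ∀ {p q} → p ↓ᴬ → (p + q) ↓ᴬ
    +↓ʳ : ∀ {p q} → p ↓ᴬ → (q + p) ↓ᴬ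
    ·↓ : ∀ {p q} → p ↓ᴬ → q ↓ᴬ → (p · q) ↓ᴬ
    *↓ : ∀ {p} → (p *) ↓ᴬ
    ∥↓ : ∀ {p q} → p ↓ᴬ → q ↓ᴬ → (p ∥ q) ↓ᴬ
    ∂↓ : ∀ {H p} → p ↓ᴬ → (∂ H p) ↓ᴬ

  data _⟶ᴬ[_]_ : ACP A → A → ACP A → Set₁ where
    act⟶ : ∀ {a} → act a ⟶ᴬ[ a ] 𝟙
    +⟶ˡ : ∀ {p q a p'} → p ⟶ᴬ[ a ] p' → (p + q) ⟶ᴬ[ a ] p'
    +⟶ʳ : ∀ {p q a p'} → p ⟶ᴬ[ a ] p' → (q + p) ⟶ᴬ[ a ] p'
    ·⟶ˡ : ∀ {p q a p'} → p ⟶ᴬ[ a ] p' → (p · q) ⟶ᴬ[ a ] (p' · q)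
    ·⟶ʳ : ∀ {p q a q'} → p ↓ᴬ → q ⟶ᴬ[ a ] q' → (p · q) ⟶ᴬ[ a ] q'
    *⟶ : ∀ {p a p'} → p ⟶ᴬ[ a ] p' → (p *) ⟶ᴬ[ a ] (p' · (p *))
    ∥⟶ˡ : ∀ {p q a p'} → p ⟶ᴬ[ a ] p' → (p ∥ q) ⟶ᴬ[ a ] (p' ∥ q)
    ∥⟶ʳ : ∀ {p q a q'} → q ⟶ᴬ[ a ] q' → (p ∥ q) ⟶ᴬ[ a ] (p ∥ q')
    ∥⟶γ : ∀ {p q a b c p' q'} → p ⟶ᴬ[ a ] p' → q ⟶ᴬ[ b ] q' → γ a b ≡ just c →
           (p ∥ q) ⟶ᴬ[ c ] (p' ∥ q')
    ∂⟶ : ∀ {H p a p'} → p ⟶ᴬ[ a ] p' → ¬ H a → ∂ H p ⟶ᴬ[ a ] ∂ H p'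

ACPUnion : (A : Set) → TSS A (lsuc 0ℓ)
ACPUnion A = record
  { State = Σ (CommFun A) (λ _ → ACP A)
  ; _⟶[_]_ = λ { (C , p) a (C' , p') → (C ≡ C') × _⟶ᴬ[_]_ C p a p' }
  ; _↓ = λ { (C , p) → _↓ᴬ C p }
  }

data PA (A : Set) : Set where
  𝟘 𝟙 : PA A
  act : A → PA A
  _·_ _+_ _∥_ : PA A → PA A → PA A
  _* : PA A → PA A

module _ {A : Set} where
  data _↓ᴾ : PA A → Set where
    𝟙↓ : 𝟙 ↓ᴾ
    +↓ˡ : ∀ {p q} → p ↓ᴾ → (p + q) ↓ᴾ
    +↓ʳ : ∀ {p q} → p ↓ᴾ → (q + p) ↓ᴾ
    ·↓ : ∀ {p q} → p ↓ᴾ → q ↓ᴾ → (p · q) ↓ᴾ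
    *↓ : ∀ {p} → (p *) ↓ᴾ
    ∥↓ : ∀ {p q} → p ↓ᴾ → q ↓ᴾ → (p ∥ q) ↓ᴾ

  data _⟶ᴾ[_]_ : PA A → A → PA A → Set where
    act⟶ : ∀ {a} → act a ⟶ᴾ[ a ] 𝟙
    +⟶ˡ : ∀ {p q a p'} → p ⟶ᴾ[ a ] p' → (p + q) ⟶ᴾ[ a ] p'
    +⟶ʳ : ∀ {p q a p'} → p ⟶ᴾ[ a ] p' → (q + p) ⟶ᴾ[ a ] p'
    ·⟶ˡ : ∀ {p q a p'} → p ⟶ᴾ[ a ] p' → (p · q) ⟶ᴾ[ a ] (p' · q)
    ·⟶ʳ : ∀ {p q a q'} → p ↓ᴾ → q ⟶ᴾ[ a ] q' → (p · q) ⟶ᴾ[ a ] q'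
    *⟶ : ∀ {p a p'} → p ⟶ᴾ[ a ] p' → (p *) ⟶ᴾ[ a ] (p' · (p *))
    ∥⟶ˡ : ∀ {p q a p'} → p ⟶ᴾ[ a ] p' → (p ∥ q) ⟶ᴾ[ a ] (p' ∥ q)
    ∥⟶ʳ : ∀ {p q a q'} → q ⟶ᴾ[ a ] q' → (p ∥ q) ⟶ᴾ[ a ] (p ∥ q')

PASpace : (A : Set) → TSS A 0ℓ
PASpace A = record { State = PA A ; _⟶[_]_ = _⟶ᴾ[_]_ ; _↓ = _↓ᴾ }

{-# OPTIONS --safe #-}
-- The witness is (a·a)*·a ∥ a with γ constantly a.  Synchronisation lets its
-- cycle of length two terminate both components in a single step, from one
-- state of the cycle only.  Without synchronisation a step of p ∥ q to a state
-- with no transitions requires p or q to be dead already, so a PA expression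
-- for this process would have to produce the cycle by · and * alone.  There,
-- the exits of a cycle that loops through a tail W must all be taken by W, and
-- are therefore the same for both states of the cycle, whereas here they differ.
module Submission where

open import Level using (_⊔_; 0ℓ) renaming (suc to lsuc)
open import Data.Empty using (⊥; ⊥-elim)
open import Data.Maybe using (just; nothing)
open import Data.Product using (Σ; _×_; _,_; proj₁; proj₂)
open import Data.Sum using (_⊎_; inj₁; inj₂)
open import Function.Bundles using (mk⇔; Equivalence)
open import Function.Properties.Equivalence using () renaming (trans to ⇔-trans)
open import Relation.Nullary using (¬_)
open import Relation.Binary.PropositionalEquality using (_≡_; refl; cong)

open import Defs

-- The levels make the composite of the two bisimulations small enough.
bisimilar-trans :
  ∀ {A : Set} {ℓ₁ ℓ₂ ℓ₃} {T₁ : TSS A ℓ₁} {T₂ : TSS A ℓ₂} {T₃ : TSS A (ℓ₂ ⊔ ℓ₃)} →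
  ∀ {s₁ s₂ s₃} → Bisimilar T₁ T₂ s₁ s₂ → Bisimilar T₂ T₃ s₂ s₃ → Bisimilar T₁ T₃ s₁ s₃
bisimilar-trans {T₁ = T₁} {T₂} {T₃} {s₂ = s₂} (R , bisR , r) (S , bisS , s) =
  (λ s₁ s₃ → Σ (TSS.State T₂) λ s₂ → R s₁ s₂ × S s₂ s₃) , bis , (s₂ , r , s)
  where
  bis : IsBisimulation T₁ T₃ (λ s₁ s₃ → Σ (TSS.State T₂) λ s₂ → R s₁ s₂ × S s₂ s₃)
  bis s₁ s₃ (s₂ , r , s) with bisR s₁ s₂ r | bisS s₂ s₃ s
  ... | forthR , backR , ↓R | forthS , backS , ↓S =
    (λ a s₁' t →
      let s₂' , t₂ , r' = forthR a s₁' t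
          s₃' , t₃ , s' = forthS a s₂' t₂
      in s₃' , t₃ , s₂' , r' , s') ,
    (λ a s₃' t →
      let s₂' , t₂ , s' = backS a s₃' t
          s₁' , t₁ , r' = backR a s₂' t₂
      in s₁' , t₁ , s₂' , r' , s') ,
    ⇔-trans ↓R ↓S

module _ {A : Set} where

  -- Embedding into the space with undefined communication

  interleaving : CommFun A
  interleaving = record { γ = λ _ _ → nothing ; comm = λ _ _ → refl ; assoc = λ _ _ _ → refl }

  embed : PA A → ACP A
  embed 𝟘 = 𝟘
  embed 𝟙 = 𝟙
  embed (act a) = act a
  embed (p · q) = embed p · embed q
  embed (p + q) = embed p + embed q
  embed (p ∥ q) = embed p ∥ embed q
  embed (p *) = embed p *

  embed-↓ : ∀ {p} → p ↓ᴾ → _↓ᴬ interleaving (embed p)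
  embed-↓ 𝟙↓ = 𝟙↓
  embed-↓ (+↓ˡ d) = +↓ˡ (embed-↓ d)
  embed-↓ (+↓ʳ d) = +↓ʳ (embed-↓ d)
  embed-↓ (·↓ d e) = ·↓ (embed-↓ d) (embed-↓ e)
  embed-↓ *↓ = *↓
  embed-↓ (∥↓ d e) = ∥↓ (embed-↓ d) (embed-↓ e)

  unembed-↓ : ∀ p → _↓ᴬ interleaving (embed p) → p ↓ᴾ
  unembed-↓ 𝟙 𝟙↓ = 𝟙↓
  unembed-↓ (p + q) (+↓ˡ d) = +↓ˡ (unembed-↓ p d)
  unembed-↓ (p + q) (+↓ʳ d) = +↓ʳ (unembed-↓ q d)
  unembed-↓ (p · q) (·↓ d e) = ·↓ (unembed-↓ p d) (unembed-↓ q e)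
  unembed-↓ (p *) *↓ = *↓
  unembed-↓ (p ∥ q) (∥↓ d e) = ∥↓ (unembed-↓ p d) (unembed-↓ q e)

  embed-⟶ : ∀ {p a p'} → p ⟶ᴾ[ a ] p' → _⟶ᴬ[_]_ interleaving (embed p) a (embed p')
  embed-⟶ act⟶ = act⟶
  embed-⟶ (+⟶ˡ t) = +⟶ˡ (embed-⟶ t)
  embed-⟶ (+⟶ʳ t) = +⟶ʳ (embed-⟶ t)
  embed-⟶ (·⟶ˡ t) = ·⟶ˡ (embed-⟶ t)
  embed-⟶ (·⟶ʳ d t) = ·⟶ʳ (embed-↓ d) (embed-⟶ t)
  embed-⟶ (*⟶ t) = *⟶ (embed-⟶ t)
  embed-⟶ (∥⟶ˡ t) = ∥⟶ˡ (embed-⟶ t)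
  embed-⟶ (∥⟶ʳ t) = ∥⟶ʳ (embed-⟶ t)

  unembed-⟶ : ∀ p {a s} → _⟶ᴬ[_]_ interleaving (embed p) a s →
              Σ (PA A) λ p' → (p ⟶ᴾ[ a ] p') × s ≡ embed p'
  unembed-⟶ (act a) act⟶ = 𝟙 , act⟶ , refl
  unembed-⟶ (p + q) (+⟶ˡ t) with unembed-⟶ p t
  ... | p' , t' , refl = p' , +⟶ˡ t' , refl
  unembed-⟶ (p + q) (+⟶ʳ t) with unembed-⟶ q t
  ... | q' , t' , refl = q' , +⟶ʳ t' , refl
  unembed-⟶ (p · q) (·⟶ˡ t) with unembed-⟶ p t
  ... | p' , t' , refl = p' · q , ·⟶ˡ t' , refl
  unembed-⟶ (p · q) (·⟶ʳ d t) with unembed-⟶ q t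
  ... | q' , t' , refl = q' , ·⟶ʳ (unembed-↓ p d) t' , refl
  unembed-⟶ (p *) (*⟶ t) with unembed-⟶ p t
  ... | p' , t' , refl = p' · (p *) , *⟶ t' , refl
  unembed-⟶ (p ∥ q) (∥⟶ˡ t) with unembed-⟶ p t
  ... | p' , t' , refl = p' ∥ q , ∥⟶ˡ t' , refl
  unembed-⟶ (p ∥ q) (∥⟶ʳ t) with unembed-⟶ q t
  ... | q' , t' , refl = p ∥ q' , ∥⟶ʳ t' , refl
  unembed-⟶ (p ∥ q) (∥⟶γ _ _ ())

  embed-bisimilar : ∀ p → Bisimilar (PASpace A) (ACPUnion A) p (interleaving , embed p)
  embed-bisimilar p = (λ p s → s ≡ (interleaving , embed p)) , bis , refl
    where
    bis : IsBisimulation (PASpace A) (ACPUnion A) (λ p s → s ≡ (interleaving , embed p))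
    bis p _ refl =
      (λ a p' t → _ , (refl , embed-⟶ t) , refl) ,
      (λ { a (_ , _) (refl , t) → let p' , t' , e = unembed-⟶ p t in p' , t' , cong (interleaving ,_) e }) ,
      mk⇔ embed-↓ (unembed-↓ p)

  -- Dead expressions and derivatives

  Dead : PA A → Set
  Dead p = ∀ {a p'} → ¬ (p ⟶ᴾ[ a ] p')

  infix 4 _∈∂_

  -- A superset of the expressions reachable from the second argument, generated along its syntax so
  -- that claims about reachable expressions can be proved by structural induction. The derivatives
  -- of `p *` carry a single copy of `p *`, however many rounds have passed.
  data _∈∂_ : PA A → PA A → Set where
    𝟘-self : 𝟘 ∈∂ 𝟘
    𝟙-self : 𝟙 ∈∂ 𝟙
    act-self : ∀ {a} → act a ∈∂ act a
    act-𝟙 : ∀ {a} → 𝟙 ∈∂ act a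
    +-self : ∀ {p q} → p + q ∈∂ p + q
    +ˡ : ∀ {p q x} → x ∈∂ p → x ∈∂ p + q
    +ʳ : ∀ {p q x} → x ∈∂ q → x ∈∂ p + q
    ·ˡ : ∀ {p q x} → x ∈∂ p → x · q ∈∂ p · q
    ·ʳ : ∀ {p q x} → x ∈∂ q → x ∈∂ p · q
    *-self : ∀ {p} → p * ∈∂ p *
    *-body : ∀ {p x} → x ∈∂ p → x · (p *) ∈∂ p *
    ∥-both : ∀ {p q x y} → x ∈∂ p → y ∈∂ q → x ∥ y ∈∂ p ∥ q

  ∈∂-refl : ∀ p → p ∈∂ p
  ∈∂-refl 𝟘 = 𝟘-self
  ∈∂-refl 𝟙 = 𝟙-self
  ∈∂-refl (act a) = act-self
  ∈∂-refl (p · q) = ·ˡ (∈∂-refl p)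
  ∈∂-refl (p + q) = +-self
  ∈∂-refl (p ∥ q) = ∥-both (∈∂-refl p) (∈∂-refl q)
  ∈∂-refl (p *) = *-self

  ∈∂-step : ∀ {p x a x'} → x ∈∂ p → x ⟶ᴾ[ a ] x' → x' ∈∂ p
  ∈∂-step act-self act⟶ = act-𝟙
  ∈∂-step (+-self {p}) (+⟶ˡ t) = +ˡ (∈∂-step (∈∂-refl p) t)
  ∈∂-step (+-self {_} {q}) (+⟶ʳ t) = +ʳ (∈∂-step (∈∂-refl q) t)
  ∈∂-step (+ˡ m) t = +ˡ (∈∂-step m t)
  ∈∂-step (+ʳ m) t = +ʳ (∈∂-step m t)
  ∈∂-step (·ˡ m) (·⟶ˡ t) = ·ˡ (∈∂-step m t)
  ∈∂-step (·ˡ {q = q} m) (·⟶ʳ d t) = ·ʳ (∈∂-step (∈∂-refl q) t)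
  ∈∂-step (·ʳ m) t = ·ʳ (∈∂-step m t)
  ∈∂-step (*-self {p}) (*⟶ t) = *-body (∈∂-step (∈∂-refl p) t)
  ∈∂-step (*-body m) (·⟶ˡ t) = *-body (∈∂-step m t)
  ∈∂-step (*-body {p} m) (·⟶ʳ d (*⟶ t)) = *-body (∈∂-step (∈∂-refl p) t)
  ∈∂-step (∥-both m n) (∥⟶ˡ t) = ∥-both (∈∂-step m t) n
  ∈∂-step (∥-both m n) (∥⟶ʳ t) = ∥-both m (∈∂-step n t)

  -- Bisimulation laws for sequential and parallel composition

  data Reassoc : PA A → PA A → Set where
    reassoc : ∀ {p q r} → Reassoc (p · (q · r)) ((p · q) · r)
    same : ∀ {p} → Reassoc p p

  ·-assoc : ∀ p q r → Bisimilar (PASpace A) (PASpace A) (p · (q · r)) ((p · q) · r)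
  ·-assoc p q r = Reassoc , bis , reassoc
    where
    bis : IsBisimulation (PASpace A) (PASpace A) Reassoc
    bis _ _ same = (λ _ s t → s , t , same) , (λ _ s t → s , t , same) , mk⇔ (λ d → d) (λ d → d)
    bis _ _ reassoc =
      (λ { _ _ (·⟶ˡ t) → _ , ·⟶ˡ (·⟶ˡ t) , reassoc
         ; _ _ (·⟶ʳ d (·⟶ˡ t)) → _ , ·⟶ˡ (·⟶ʳ d t) , same
         ; _ _ (·⟶ʳ d (·⟶ʳ e t)) → _ , ·⟶ʳ (·↓ d e) t , same }) ,
      (λ { _ _ (·⟶ˡ (·⟶ˡ t)) → _ , ·⟶ˡ t , reassoc
         ; _ _ (·⟶ˡ (·⟶ʳ d t)) → _ , ·⟶ʳ d (·⟶ˡ t) , same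
         ; _ _ (·⟶ʳ (·↓ d e) t) → _ , ·⟶ʳ d (·⟶ʳ e t) , same }) ,
      mk⇔ (λ { (·↓ d (·↓ e f)) → ·↓ (·↓ d e) f }) (λ { (·↓ (·↓ d e) f) → ·↓ d (·↓ e f) })

  data DropRight (y : PA A) : PA A → PA A → Set where
    drop : ∀ {x q} → DropRight y (x · q) ((x ∥ y) · q)
    same : ∀ {p} → DropRight y p p

  -- A terminated dead `y` contributes no step and never blocks termination. The law is stated under
  -- a continuation `q`, the form in which the induction meets parallel compositions.
  ∥-identityʳ : ∀ {y} → y ↓ᴾ → Dead y →
                ∀ x q → Bisimilar (PASpace A) (PASpace A) (x · q) ((x ∥ y) · q)
  ∥-identityʳ {y} y↓ dead x q = DropRight y , bis , drop
    where
    bis : IsBisimulation (PASpace A) (PASpace A) (DropRight y)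
    bis _ _ same = (λ _ s t → s , t , same) , (λ _ s t → s , t , same) , mk⇔ (λ d → d) (λ d → d)
    bis _ _ drop =
      (λ { _ _ (·⟶ˡ t) → _ , ·⟶ˡ (∥⟶ˡ t) , drop
         ; _ _ (·⟶ʳ d t) → _ , ·⟶ʳ (∥↓ d y↓) t , same }) ,
      (λ { _ _ (·⟶ˡ (∥⟶ˡ t)) → _ , ·⟶ˡ t , drop
         ; _ _ (·⟶ˡ (∥⟶ʳ t)) → ⊥-elim (dead t)
         ; _ _ (·⟶ʳ (∥↓ d e) t) → _ , ·⟶ʳ d t , same }) ,
      mk⇔ (λ { (·↓ d e) → ·↓ (∥↓ d y↓) e }) (λ { (·↓ (∥↓ d _) e) → ·↓ d e })

  data DropUnit : PA A → PA A → Set where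
    drop : ∀ {p} → DropUnit (p · 𝟙) p

  ·-identityʳ : ∀ p → Bisimilar (PASpace A) (PASpace A) (p · 𝟙) p
  ·-identityʳ p = DropUnit , bis , drop
    where
    bis : IsBisimulation (PASpace A) (PASpace A) DropUnit
    bis _ _ drop =
      (λ { _ _ (·⟶ˡ t) → _ , t , drop ; _ _ (·⟶ʳ _ ()) }) ,
      (λ _ _ t → _ , ·⟶ˡ t , drop) ,
      mk⇔ (λ { (·↓ d 𝟙↓) → d }) (λ d → ·↓ d 𝟙↓)

  data Swap : PA A → PA A → Set where
    swap : ∀ {x y q} → Swap ((x ∥ y) · q) ((y ∥ x) · q)
    same : ∀ {p} → Swap p p

  ∥-comm : ∀ x y q → Bisimilar (PASpace A) (PASpace A) ((x ∥ y) · q) ((y ∥ x) · q)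
  ∥-comm x y q = Swap , bis , swap
    where
    bis : IsBisimulation (PASpace A) (PASpace A) Swap
    bis _ _ same = (λ _ s t → s , t , same) , (λ _ s t → s , t , same) , mk⇔ (λ d → d) (λ d → d)
    bis _ _ swap =
      (λ { _ _ (·⟶ˡ (∥⟶ˡ t)) → _ , ·⟶ˡ (∥⟶ʳ t) , swap
         ; _ _ (·⟶ˡ (∥⟶ʳ t)) → _ , ·⟶ˡ (∥⟶ˡ t) , swap
         ; _ _ (·⟶ʳ (∥↓ d e) t) → _ , ·⟶ʳ (∥↓ e d) t , same }) ,
      (λ { _ _ (·⟶ˡ (∥⟶ˡ t)) → _ , ·⟶ˡ (∥⟶ʳ t) , swap
         ; _ _ (·⟶ˡ (∥⟶ʳ t)) → _ , ·⟶ˡ (∥⟶ˡ t) , swap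
         ; _ _ (·⟶ʳ (∥↓ d e) t) → _ , ·⟶ʳ (∥↓ e d) t , same }) ,
      mk⇔ (λ { (·↓ (∥↓ d e) f) → ·↓ (∥↓ e d) f }) (λ { (·↓ (∥↓ d e) f) → ·↓ (∥↓ e d) f })

-- The transition graph of the witness

-- The states of (a·a)*·a (even, odd, done) and of a (last, done).
data Phase : Set₁ where
  even odd last done : Phase

data _↝_ : Phase → Phase → Set₁ where
  even↝odd : even ↝ odd
  even↝done : even ↝ done
  odd↝even : odd ↝ even
  last↝done : last ↝ done

Node : Set₁
Node = Phase × Phase

data _⇒_ : Node → Node → Set₁ where
  left : ∀ {p q p'} → p ↝ p' → (p , q) ⇒ (p' , q)
  right : ∀ {p q q'} → q ↝ q' → (p , q) ⇒ (p , q')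
  both : ∀ {p q p' q'} → p ↝ p' → q ↝ q' → (p , q) ⇒ (p' , q')

-- The cycle on which the second component is still to act; `(even , done)` and `(odd , done)` form
-- another cycle, which has to be told apart from it.
data Core : Node → Set₁ where
  even-last : Core (even , last)
  odd-last : Core (odd , last)

core-next : ∀ {g} → Core g → Σ Node λ g' → g ⇒ g' × Core g'
core-next even-last = _ , left even↝odd , odd-last
core-next odd-last = _ , left odd↝even , even-last

module Witness {A : Set} (a : A) where

  SyncGraph : TSS A (lsuc 0ℓ)
  SyncGraph = record
    { State = Node
    ; _⟶[_]_ = λ g b g' → b ≡ a × g ⇒ g'
    ; _↓ = λ g → g ≡ (done , done)
    }

  constant : CommFun A
  constant = record { γ = λ _ _ → just a ; comm = λ _ _ → refl ; assoc = λ _ _ _ → refl }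

  loop : ACP A
  loop = (act a · act a) *

  witness : ACP A
  witness = (loop · act a) ∥ act a

  -- The phase `even` has two expressions, since each completed round leaves a factor `𝟙` in front
  -- of `loop`.
  data _▷_ : ACP A → Phase → Set₁ where
    even₀ : (loop · act a) ▷ even
    even₁ : ((𝟙 · loop) · act a) ▷ even
    odd₁ : (((𝟙 · act a) · loop) · act a) ▷ odd
    last₀ : act a ▷ last
    done₀ : 𝟙 ▷ done

  ▷-↓ : ∀ {u p} → u ▷ p → _↓ᴬ constant u → p ≡ done
  ▷-↓ even₀ (·↓ _ ())
  ▷-↓ even₁ (·↓ _ ())
  ▷-↓ odd₁ (·↓ _ ())
  ▷-↓ done₀ 𝟙↓ = refl

  ▷-forth : ∀ {u p b u'} → u ▷ p → _⟶ᴬ[_]_ constant u b u' →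
            b ≡ a × Σ Phase λ p' → p ↝ p' × u' ▷ p'
  ▷-forth even₀ (·⟶ˡ (*⟶ (·⟶ˡ act⟶))) = refl , _ , even↝odd , odd₁
  ▷-forth even₀ (·⟶ˡ (*⟶ (·⟶ʳ () _)))
  ▷-forth even₀ (·⟶ʳ *↓ act⟶) = refl , _ , even↝done , done₀
  ▷-forth even₁ (·⟶ˡ (·⟶ˡ ()))
  ▷-forth even₁ (·⟶ˡ (·⟶ʳ 𝟙↓ (*⟶ (·⟶ˡ act⟶)))) = refl , _ , even↝odd , odd₁
  ▷-forth even₁ (·⟶ˡ (·⟶ʳ 𝟙↓ (*⟶ (·⟶ʳ () _))))
  ▷-forth even₁ (·⟶ʳ _ act⟶) = refl , _ , even↝done , done₀
  ▷-forth odd₁ (·⟶ˡ (·⟶ˡ (·⟶ˡ ())))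
  ▷-forth odd₁ (·⟶ˡ (·⟶ˡ (·⟶ʳ _ act⟶))) = refl , _ , odd↝even , even₁
  ▷-forth odd₁ (·⟶ˡ (·⟶ʳ (·↓ _ ()) _))
  ▷-forth odd₁ (·⟶ʳ (·↓ (·↓ _ ()) _) _)
  ▷-forth last₀ act⟶ = refl , _ , last↝done , done₀

  ▷-back : ∀ {u p p'} → u ▷ p → p ↝ p' → Σ (ACP A) λ u' → _⟶ᴬ[_]_ constant u a u' × u' ▷ p'
  ▷-back even₀ even↝odd = _ , ·⟶ˡ (*⟶ (·⟶ˡ act⟶)) , odd₁
  ▷-back even₀ even↝done = _ , ·⟶ʳ *↓ act⟶ , done₀
  ▷-back even₁ even↝odd = _ , ·⟶ˡ (·⟶ʳ 𝟙↓ (*⟶ (·⟶ˡ act⟶))) , odd₁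
  ▷-back even₁ even↝done = _ , ·⟶ʳ (·↓ 𝟙↓ *↓) act⟶ , done₀
  ▷-back odd₁ odd↝even = _ , ·⟶ˡ (·⟶ˡ (·⟶ʳ 𝟙↓ act⟶)) , even₁
  ▷-back last₀ last↝done = _ , act⟶ , done₀

  data Represents : TSS.State (ACPUnion A) → Node → Set₁ where
    represents : ∀ {u v p q} → u ▷ p → v ▷ q → Represents (constant , (u ∥ v)) (p , q)

  witness-bisimilar : Bisimilar (ACPUnion A) SyncGraph (constant , witness) (even , last)
  witness-bisimilar = Represents , bis , represents even₀ last₀
    where
    bis : IsBisimulation (ACPUnion A) SyncGraph Represents
    bis _ _ (represents m n) = forth , back , mk⇔ ↓⇒ (↓⇐ m n)
      where
      forth : ∀ b s' → TSS._⟶[_]_ (ACPUnion A) _ b s' →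
              Σ Node λ g' → TSS._⟶[_]_ SyncGraph _ b g' × Represents s' g'
      forth b (_ , _) (refl , ∥⟶ˡ t) =
        let e , _ , st , m' = ▷-forth m t in _ , (e , left st) , represents m' n
      forth b (_ , _) (refl , ∥⟶ʳ t) =
        let e , _ , st , n' = ▷-forth n t in _ , (e , right st) , represents m n'
      forth b (_ , _) (refl , ∥⟶γ t t' refl) =
        let _ , _ , st , m' = ▷-forth m t
            _ , _ , st' , n' = ▷-forth n t'
        in _ , (refl , both st st') , represents m' n'

      back : ∀ b g' → TSS._⟶[_]_ SyncGraph _ b g' →
             Σ (TSS.State (ACPUnion A)) λ s' → TSS._⟶[_]_ (ACPUnion A) _ b s' × Represents s' g'
      back b _ (refl , left st) =
        let _ , t , m' = ▷-back m st in _ , (refl , ∥⟶ˡ t) , represents m' n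
      back b _ (refl , right st) =
        let _ , t , n' = ▷-back n st in _ , (refl , ∥⟶ʳ t) , represents m n'
      back b _ (refl , both st st') =
        let _ , t , m' = ▷-back m st
            _ , t' , n' = ▷-back n st'
        in _ , (refl , ∥⟶γ t t' refl) , represents m' n'

      ↓⇒ : _↓ᴬ constant _ → _
      ↓⇒ (∥↓ d e) with ▷-↓ m d | ▷-↓ n e
      ... | refl | refl = refl

      ↓⇐ : ∀ {u v p q} → u ▷ p → v ▷ q → (p , q) ≡ (done , done) → _↓ᴬ constant (u ∥ v)
      ↓⇐ done₀ done₀ refl = ∥↓ 𝟙↓ 𝟙↓

  -- PA expressions bisimilar to nodes of the graph

  infix 4 _≈_

  _≈_ : PA A → Node → Set₂
  s ≈ g = Bisimilar (PASpace A) SyncGraph s g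

  ≈-forth : ∀ {s g b s'} → s ≈ g → s ⟶ᴾ[ b ] s' → Σ Node λ g' → g ⇒ g' × s' ≈ g'
  ≈-forth (R , bis , r) t =
    let g' , (_ , e) , r' = proj₁ (bis _ _ r) _ _ t in g' , e , R , bis , r'

  ≈-back : ∀ {s g g'} → s ≈ g → g ⇒ g' → Σ (PA A) λ s' → s ⟶ᴾ[ a ] s' × s' ≈ g'
  ≈-back (R , bis , r) e =
    let s' , t , r' = proj₁ (proj₂ (bis _ _ r)) _ _ (refl , e) in s' , t , R , bis , r'

  ≈-↓ : ∀ {s g} → s ≈ g → s ↓ᴾ → g ≡ (done , done)
  ≈-↓ (R , bis , r) = Equivalence.to (proj₂ (proj₂ (bis _ _ r)))

  end-↓ : ∀ {s} → s ≈ (done , done) → s ↓ᴾ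
  end-↓ (R , bis , r) = Equivalence.from (proj₂ (proj₂ (bis _ _ r))) refl

  end-dead : ∀ {s} → s ≈ (done , done) → Dead s
  end-dead s≈ t with ≈-forth s≈ t
  ... | _ , left () , _
  ... | _ , right () , _
  ... | _ , both () _ , _

  ≈-resp : ∀ {s t g} → Bisimilar (PASpace A) (PASpace A) s t → t ≈ g → s ≈ g
  ≈-resp = bisimilar-trans {ℓ₃ = lsuc 0ℓ}

  data EndFactors (x q : PA A) : Set where
    end-factors : x ↓ᴾ → Dead x → q ↓ᴾ → Dead q → EndFactors x q

  ·-end : ∀ {x q} → x · q ≈ (done , done) → EndFactors x q
  ·-end s≈ with end-↓ s≈
  ... | ·↓ d e = end-factors d (λ t → end-dead s≈ (·⟶ˡ t)) e (λ t → end-dead s≈ (·⟶ʳ d t))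

  -- `(odd , done)` has a single edge. Its target is not terminated, which separates this node from
  -- every node with an edge to the end.
  odd-step : ∀ {s b s'} → s ≈ (odd , done) → s ⟶ᴾ[ b ] s' → s' ≈ (even , done)
  odd-step s≈ t with ≈-forth s≈ t
  ... | _ , left odd↝even , s'≈ = s'≈

  even≉odd : ∀ {s} → s ≈ (even , done) → ¬ s ≈ (odd , done)
  even≉odd s≈ s≈' with ≈-back s≈ (left even↝done)
  ... | _ , t , e with ≈-↓ (odd-step s≈' t) (end-↓ e)
  ... | ()

  finishing≉odd : ∀ {s g} → s ≈ g → g ⇒ (done , done) → ¬ s ≈ (odd , done)
  finishing≉odd s≈ f s≈' with ≈-back s≈ f
  ... | _ , t , e with ≈-↓ (odd-step s≈' t) (end-↓ e)
  ... | ()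

  core≉odd : ∀ {s g} → Core g → s ≈ g → ¬ s ≈ (odd , done)
  core≉odd even-last s≈ = finishing≉odd s≈ (both even↝done last↝done)
  -- `(odd , last)` has no edge to the end either, so the difference shows one step later: its right
  -- edge leads to `(odd , done)`, not to `(even , done)`.
  core≉odd odd-last s≈ s≈' =
    let _ , t , o = ≈-back s≈ (right last↝done) in even≉odd (odd-step s≈' t) o

  core≉end : ∀ {s g} → Core g → s ≈ g → ¬ s ≈ (done , done)
  core≉end c s≈ s≈' =
    let _ , e , _ = core-next c
        _ , t , _ = ≈-back s≈ e
    in end-dead s≈' t

  last≉even-step : ∀ {s b s'} → s ≈ (even , done) → s ⟶ᴾ[ b ] s' → ¬ s' ≈ (done , last)
  last≉even-step s≈ t l with ≈-forth s≈ t
  ... | _ , left even↝odd , o = finishing≉odd l (right last↝done) o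
  ... | _ , left even↝done , e = end-dead e (proj₁ (proj₂ (≈-back l (right last↝done))))

  core≉even-step : ∀ {s b s' g} → s ≈ (even , done) → s ⟶ᴾ[ b ] s' → Core g → ¬ s' ≈ g
  core≉even-step s≈ t c s'≈ with ≈-forth s≈ t
  ... | _ , left even↝odd , o = core≉odd c s'≈ o
  ... | _ , left even↝done , e = core≉end c s'≈ e

  -- Each edge of `(odd , last)` leaves the first component at `odd` or `even`. This is the exit
  -- that separates the two core nodes.
  odd-last-no-end : ∀ {s b s'} → s ≈ (odd , last) → s ⟶ᴾ[ b ] s' → ¬ s' ≈ (done , done)
  odd-last-no-end s≈ t e with ≈-forth s≈ t
  ... | _ , left odd↝even , s'≈ with () ← ≈-↓ s'≈ (end-↓ e)
  odd-last-no-end s≈ t e | _ , right last↝done , s'≈ with () ← ≈-↓ s'≈ (end-↓ e)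
  odd-last-no-end s≈ t e | _ , both odd↝even last↝done , s'≈ with () ← ≈-↓ s'≈ (end-↓ e)

  -- Tails that re-enter the cycle, and iteration

  -- Every construct is shown to pass the cycle on to its tail in this sense, which is absurd for
  -- the tail `𝟙`.
  data Escapes (q : PA A) : Set₂ where
    escapes : ∀ {b q' g} → q ⟶ᴾ[ b ] q' → q' ≈ g → Core g → Escapes q

  data Advance (x q : PA A) : Node → Set₂ where
    tail : ∀ {b q' g} → x ↓ᴾ → q ⟶ᴾ[ b ] q' → q' ≈ g → Advance x q g
    head : ∀ {b x' g} → x ⟶ᴾ[ b ] x' → x' · q ≈ g → Advance x q g

  advance : ∀ {x q g g'} → x · q ≈ g → g ⇒ g' → Advance x q g'
  advance s≈ e with ≈-back s≈ e
  ... | _ , ·⟶ˡ t , s'≈ = head t s'≈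
  ... | _ , ·⟶ʳ d t , s'≈ = tail d t s'≈

  -- The step from x · q to the end must be taken by q, as q is not dead.  From
  -- y · q the exit to (even , done) cannot be taken inside y, because q, hence a
  -- core node, would remain reachable.  So y ↓, and q's step to the end is
  -- available from y · q as well.
  no-shared-tail : ∀ {x y q} → x · q ≈ (even , last) → y · q ≈ (odd , last) → ¬ Escapes q
  no-shared-tail x≈ y≈ (escapes t s≈ c) with advance x≈ (both even↝done last↝done)
  ... | head _ e with ·-end e
  ...   | end-factors _ _ _ q-dead = q-dead t
  no-shared-tail x≈ y≈ (escapes t s≈ c) | tail _ u e with advance y≈ (both odd↝even last↝done)
  ...   | tail y↓ _ _ = odd-last-no-end y≈ (·⟶ʳ y↓ u) e
  ...   | head _ z≈ with advance z≈ (left even↝done)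
  ...     | tail z↓ _ _ = core≉even-step z≈ (·⟶ʳ z↓ t) c s≈
  ...     | head _ w≈ with ·-end w≈
  ...       | end-factors _ _ _ q-dead = q-dead t

  -- If `p *` takes the step, a core node has the form `x · ((p *) · q)`. Were the next core node
  -- again of this form, the two would share an escaping tail, against `no-shared-tail`. So `q`
  -- itself takes the next step along the cycle.
  *-escapes : ∀ {p q} → Escapes ((p *) · q) → Escapes q
  *-escapes (escapes (·⟶ʳ _ t) s≈ c) = escapes t s≈ c
  *-escapes {p} {q} esc@(escapes (·⟶ˡ (*⟶ {p' = x} t)) s≈ c) = step c (≈-resp (·-assoc x (p *) q) s≈)
    where
    pair : ∀ {x y g g'} → Core g → g ⇒ g' → Core g' → x · ((p *) · q) ≈ g → y · ((p *) · q) ≈ g' → ⊥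
    pair even-last _ odd-last x≈ y≈ = no-shared-tail x≈ y≈ esc
    pair odd-last _ even-last x≈ y≈ = no-shared-tail y≈ x≈ esc
    pair even-last (left ()) even-last
    pair odd-last (left ()) odd-last

    step : ∀ {x g} → Core g → x · ((p *) · q) ≈ g → Escapes q
    step c x≈ with core-next c
    ... | _ , e , c' with advance x≈ e
    ...   | head _ y≈ = ⊥-elim (pair c e c' x≈ y≈)
    ...   | tail _ (·⟶ʳ _ t) s≈ = escapes t s≈ c'
    ...   | tail _ (·⟶ˡ (*⟶ {p' = y} t)) s≈ =
              ⊥-elim (pair c e c' x≈ (≈-resp (·-assoc y (p *) q) s≈))

  -- Parallel composition

  data Unit∥ (x y : PA A) : Set where
    unitˡ : x ↓ᴾ → Dead x → Unit∥ x y
    unitʳ : y ↓ᴾ → Dead y → Unit∥ x y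

  -- Only one side moves in an interleaving step; the other is unchanged in the target, hence
  -- already terminated and dead.
  ∥-step-to-dead : ∀ {x y b z} → (x ∥ y) ⟶ᴾ[ b ] z → z ↓ᴾ → Dead z → Unit∥ x y
  ∥-step-to-dead (∥⟶ˡ t) (∥↓ _ e) dead = unitʳ e (λ u → dead (∥⟶ʳ u))
  ∥-step-to-dead (∥⟶ʳ t) (∥↓ d _) dead = unitˡ d (λ u → dead (∥⟶ˡ u))

  -- If the exit to the end is not taken by x ∥ y, it is taken by q.  Suppose q
  -- takes the exit to (done , last) too.  If q does not escape, then (odd , last)
  -- and (even , done) are reached as z · q, and z ↓ in the latter, so q's step
  -- to (done , last) would be available from (even , done).  Hence x ∥ y takes
  -- that exit, by a step to a dead terminated expression.
  ∥-trivial : ∀ {x y q} → (x ∥ y) · q ≈ (even , last) → Unit∥ x y ⊎ Escapes q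
  ∥-trivial s≈ with advance s≈ (both even↝done last↝done)
  ... | head t e with ·-end e
  ...   | end-factors z↓ z-dead _ _ = inj₁ (∥-step-to-dead t z↓ z-dead)
  ∥-trivial s≈ | tail _ u e with advance s≈ (left even↝done)
  ...   | head t l with advance l (right last↝done)
  ...     | head _ e' with ·-end e'
  ...       | end-factors _ _ _ q-dead = ⊥-elim (q-dead u)
  ∥-trivial s≈ | tail _ u e | head t l | tail z↓ _ _ = inj₁ (∥-step-to-dead t z↓ z-dead)
    where
    z-dead : Dead _
    -- A step of `z` would lead to the end with tail `q`, forcing `q` to be dead, although `u` is a
    -- step of `q`.
    z-dead v with ≈-forth l (·⟶ˡ v)
    ... | _ , right last↝done , e' with ·-end e'
    ...   | end-factors _ _ _ q-dead = q-dead u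
  ∥-trivial s≈ | tail _ u e | tail _ v l with advance s≈ (left even↝odd)
  ...   | tail _ w o = inj₂ (escapes w o odd-last)
  ...   | head _ o with advance o (both odd↝even last↝done)
  ...     | tail x↓ _ _ = ⊥-elim (odd-last-no-end o (·⟶ʳ x↓ u) e)
  ...     | head _ z≈ with advance z≈ (left even↝done)
  ...       | tail z↓ _ _ = ⊥-elim (last≉even-step z≈ (·⟶ʳ z↓ v) l)
  ...       | head _ e' with ·-end e'
  ...         | end-factors _ _ _ q-dead = ⊥-elim (q-dead u)

  -- Structural induction over PA expressions

  -- The induction hypothesis ranges over all tails, because sequencing and iteration extend the
  -- tail of a subterm, and over all derivatives, because the cycle may be entered anywhere.
  CoreEscapes : PA A → Set₂
  CoreEscapes p = ∀ {x q g} → x ∈∂ p → x · q ≈ g → Core g → Escapes q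

  -- When one side is a unit, the other alone carries the cycle with the same tail, so its own
  -- hypothesis applies.
  ∥-core-escapes-even : ∀ {p r z q} → CoreEscapes p → CoreEscapes r →
                        z ∈∂ p ∥ r → z · q ≈ (even , last) → Escapes q
  ∥-core-escapes-even esc-p esc-r (∥-both m n) s≈ with ∥-trivial s≈
  ... | inj₂ esc = esc
  ... | inj₁ (unitʳ y↓ dead) = esc-p m (≈-resp (∥-identityʳ y↓ dead _ _) s≈) even-last
  ... | inj₁ (unitˡ x↓ dead) =
          esc-r n (≈-resp (∥-identityʳ x↓ dead _ _) (≈-resp (∥-comm _ _ _) s≈)) even-last

  -- `∥-trivial` starts from an edge to the end, which only `(even , last)` has; from `(odd , last)`
  -- the cycle is first followed for one step.
  ∥-core-escapes : ∀ {p r} → CoreEscapes p → CoreEscapes r → CoreEscapes (p ∥ r)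
  ∥-core-escapes esc-p esc-r m s≈ even-last = ∥-core-escapes-even esc-p esc-r m s≈
  ∥-core-escapes esc-p esc-r m s≈ odd-last with advance s≈ (left odd↝even)
  ... | tail _ t s'≈ = escapes t s'≈ even-last
  ... | head t s'≈ = ∥-core-escapes-even esc-p esc-r (∈∂-step m t) s'≈

  core-escapes : ∀ p → CoreEscapes p
  core-escapes 𝟘 𝟘-self s≈ c with core-next c
  ... | _ , e , c' with advance s≈ e
  ...   | head () _
  ...   | tail () _ _
  core-escapes 𝟙 𝟙-self s≈ c with core-next c
  ... | _ , e , c' with advance s≈ e
  ...   | tail _ t s'≈ = escapes t s'≈ c'
  core-escapes (act b) act-self s≈ c with core-next c
  ... | _ , e , c' with advance s≈ e
  ...   | head act⟶ s'≈ = core-escapes 𝟙 𝟙-self s'≈ c'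
  core-escapes (act b) act-𝟙 s≈ c = core-escapes 𝟙 𝟙-self s≈ c
  -- One step along the cycle resolves the choice, leaving a derivative of a summand unless the tail
  -- moves.
  core-escapes (p + r) +-self s≈ c with core-next c
  ... | _ , e , c' with advance s≈ e
  ...   | tail _ t s'≈ = escapes t s'≈ c'
  ...   | head (+⟶ˡ t) s'≈ = core-escapes p (∈∂-step (∈∂-refl p) t) s'≈ c'
  ...   | head (+⟶ʳ t) s'≈ = core-escapes r (∈∂-step (∈∂-refl r) t) s'≈ c'
  core-escapes (p + r) (+ˡ m) s≈ c = core-escapes p m s≈ c
  core-escapes (p + r) (+ʳ m) s≈ c = core-escapes r m s≈ c
  core-escapes (p · r) (·ʳ m) s≈ c = core-escapes r m s≈ c
  -- For `p` the tail is `r · q`. It escapes through `q` directly, or through `r`, whose derivative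
  -- then carries the cycle.
  core-escapes (p · r) (·ˡ m) s≈ c with core-escapes p m (≈-resp (·-assoc _ _ _) s≈) c
  ... | escapes (·⟶ˡ t) s'≈ c' = core-escapes r (∈∂-step (∈∂-refl r) t) s'≈ c'
  ... | escapes (·⟶ʳ _ t) s'≈ c' = escapes t s'≈ c'
  core-escapes (p *) *-self s≈ c with core-next c
  ... | _ , e , c' with ≈-back s≈ e
  ...   | _ , t , s'≈ = *-escapes (escapes t s'≈ c')
  core-escapes (p *) (*-body m) s≈ c = *-escapes (core-escapes p m (≈-resp (·-assoc _ _ _) s≈) c)
  core-escapes (p ∥ r) = ∥-core-escapes (core-escapes p) (core-escapes r)

  not-PA : ∀ s → ¬ s ≈ (even , last)
  not-PA s s≈ with core-escapes s (∈∂-refl s) (≈-resp (·-identityʳ s) s≈) even-last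
  ... | escapes () _ _

theorem35 : (A : Set) → A → LessExpressive (PASpace A) (ACPUnion A)
theorem35 A a =
  (λ p → _ , embed-bisimilar p) ,
  (constant , witness) ,
  λ p p~w → not-PA p (bisimilar-trans {ℓ₃ = 0ℓ} p~w witness-bisimilar)
  where open Witness a
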